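{- For all integers $k \geq 0$ and $n \geq 0$, the assembly procedure $\Phi^k_n$ (described in the context), which assigns to each planar rooted forest with $k+1$ trees and $n$ total edges the leaf that it contributes to the $k$-extended action graph $A^k_n$, defines a bijection between the set of planar rooted forests with $k+1$ trees and $n$ total edges and the set of leaves of $A^k_n$.
   Context: Directed graphs: a directed graph is a pair $(V,E)$ where $V$ is a set of vertices and $E$ is a set of ordered pairs of vertices, called edges; the edge $e=(v,w)$ has source $s(e) = v$ and target $t(e) = w$. It is assumed that $(v,v) \in E$ for every $v \in V$; these edges are called trivial edges, and there are no other loops and no multiple edges. A (directed) path is a sequence of edges $e_1, \ldots, e_m$ ($m \geq 1$) with $t(e_i) = s(e_{i+1})$ for $1 \leq i < m$, where if $m > 1$ all the edges are required to be nontrivial. Its initial vertex is $s(e_1)$ and its terminal vertex is $t(e_m)$. In particular, each vertex $v$ gives exactly one trivial path from $v$ to $v$. A labeling of a directed graph by a set $S$ is a function $V \to S$. $k$-extended action graphs: for $k \geq 0$, the graphs $A^k_n$, $n \geq 0$, are directed graphs labeled by $\mathbb{N} \cup \{ -k, -k+1, \ldots, -1\}$ (with $0\in\mathbb{N}$; for $k=0$ the label set is $\mathbb{N}$), defined inductively. The graph $A^k_0$ is the linear graph $\bullet_{ -k} \to \bullet_{ -k+1} \to \cdots \to \bullet_{ -1} \to \bullet_0$ with $k+1$ vertices labeled $-k, \ldots, 0$ (for $k=0$ it is a single vertex labeled $0$ with no nontrivial edges). Given $A^k_n$, the graph $A^k_{n+1}$ is obtained by freely adjoining new edges as follows: for each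 vertex $v$ of $A^k_n$ labeled by $n$ and each path in $A^k_n$ with terminal vertex $v$ (including the trivial path at $v$), adjoin one new edge whose source is the initial vertex of that path and whose target is a new vertex labeled by $n+1$ (distinct paths give distinct new vertices). Leaves: ignoring trivial edges, $A^k_n$ is a tree, rooted at the vertex labeled $-k$. A leaf of a rooted tree is a vertex of valence $1$ that is not the root; in a tree consisting of a single vertex, that vertex is both the root and a leaf. The leaves of $A^k_n$ are precisely its vertices labeled by $n$. Planar rooted forests: a planar rooted tree is a (finite) rooted tree in which the children of each vertex carry a left-to-right linear order, considered up to isomorphism preserving the root and these orders; a single vertex is allowed. A planar rooted forest with $k+1$ trees is an ordered $(k+1)$-tuple of planar rooted trees (repetitions allowed), arranged from left to right; its number of edges is the total over its trees. Canonical labeling: in a planar rooted forest with $k+1$ trees and $n$ edges, the roots are labeled, from left to right, $-k, -k+1, \ldots, -1, 0$. The $n$ non-root vertices are then labeled $1, 2, \ldots, n$ working from bottom to top and from right to left: the trees are treated from right to left, and within each tree the vertices are visited in depth-first order in which each vertex precedes its descendants and, among the children of a vertex, each child together with all of its descendants is visited before any child to its left. The procedure $\Phi^k_n$, defined recursively in $n$: the unique planar rooted forest with $k+1$ trees and no edges is sent by $\Phi^k_0$ to the vertex of $A^k_0$ labeled $0$. For a planar rooted forest $F$ with $k+1$ trees and $n+1$ edges, let $p$ be the label of the parent, in $F$, of the vertex labeled $n+1$, and let $F'$ be the forest with $n$ edges obtained from $F$ by deleting the vertex labeled $n+1$ (necessarily a childless vertex) and the edge joining it to its parent. Let $v' =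 \Phi^k_n(F')$, a vertex of $A^k_n$ labeled $n$. Consider the path in $A^k_n$ with terminal vertex $v'$ whose initial vertex is the vertex with label $p$ lying on the directed path from the vertex labeled $-k$ to $v'$ (this is the trivial path at $v'$ if $p=n$). Then $\Phi^k_{n+1}(F)$ is the new vertex labeled $n+1$ of $A^k_{n+1}$ adjoined for this path. Labels strictly increase along nontrivial edges, so there is at most one such initial vertex; its existence is part of the assertion that the procedure is well defined. -}

module Defs where

open import Data.Bool using (if_then_else_)
open import Data.Fin using (Fin; zero; toℕ)
open import Data.Integer as ℤ using (ℤ; +_; -_; _⊖_)
import Data.Integer.Properties as ℤₚ
open import Data.List using (List; []; _∷_)
open import Data.List.Relation.Unary.Any using (Any)
open import Data.Nat using (ℕ; zero; suc; _+_; z≤n)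
import Data.Nat.Properties as ℕₚ
open import Data.Product using (Σ-syntax; _×_; proj₁)
open import Data.Sum using (_⊎_)
open import Data.Unit using (⊤; tt)
open import Data.Vec as Vec using (Vec; []; _∷_)
import Data.Vec.Relation.Unary.Any as VecAny
open import Function using (_↔_)
open import Level using (0ℓ)
open import Relation.Binary using (Rel; Irreflexive; Irrelevant)
open import Relation.Binary.Construct.Closure.ReflexiveTransitive using (Star)
open import Relation.Binary.PropositionalEquality
  using (_≡_; _≢_; refl; sym; cong; subst)
open import Relation.Nullary.Decidable using (does)
open import Axiom.UniquenessOfIdentityProofs.WithK using (uip)

------------------------------------------------------------------------
-- Directed graphs

-- The trivial edges (v , v) are left implicit: _⟶_ is the relation
-- "(v , w) is a nontrivial edge".  There are no other loops
-- (irreflexivity) and no multiple edges (irrelevance).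
record DirectedGraph : Set₁ where
  field
    Vertex      : Set
    _⟶_         : Rel Vertex 0ℓ
    irreflexive : Irreflexive _≡_ _⟶_
    irrelevant  : Irrelevant _⟶_

  -- A path from u to v is either the single trivial edge at u = v,
  -- represented by ε, or a nonempty composable sequence of nontrivial
  -- edges, represented by a sequence built with _◅_.
  Path : Rel Vertex 0ℓ
  Path = Star _⟶_

  IncidentEdge : Vertex → Set
  IncidentEdge v = Σ[ w ∈ Vertex ] ((v ⟶ w) ⊎ (w ⟶ v))

  HasValence : Vertex → ℕ → Set
  HasValence v d = IncidentEdge v ↔ Fin d

  -- Leaves of the graph regarded as a tree with the given root.
  IsLeaf : (root : Vertex) → Vertex → Set
  IsLeaf root v = (v ≢ root × HasValence v 1)
                ⊎ (v ≡ root × (∀ w → w ≡ root))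

record LabeledGraph (S : Set) : Set₁ where
  field
    graph : DirectedGraph
  open DirectedGraph graph public
  field
    label : Vertex → S

------------------------------------------------------------------------
-- Extended action graphs

-- The set ℕ ∪ {-k , … , -1}.
record Label (k : ℕ) : Set where
  constructor mkLabel
  field
    value    : ℤ
    .bounded : - (+ k) ℤ.≤ value

open Label public

linear : (k : ℕ) → LabeledGraph (Label k)
linear k = record
  { graph = record
    { Vertex      = Fin (suc k)
    ; _⟶_         = λ i j → toℕ j ≡ suc (toℕ i)
    ; irreflexive = λ { refl eq → ℕₚ.1+n≢n (sym eq) }
    ; irrelevant  = uip
    }
  ; label = λ i → mkLabel (toℕ i ⊖ k) (bound i)
  }
  where
  bound : (i : Fin (suc k)) → - (+ k) ℤ.≤ toℕ i ⊖ k
  bound i = subst (ℤ._≤ toℕ i ⊖ k) (ℤₚ.⊖-≤ z≤n) (ℤₚ.⊖-monoˡ-≤ k z≤n)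

module Adjoin {k : ℕ} (G : LabeledGraph (Label k)) (n : ℕ) where
  open LabeledGraph G

  data Vertex⁺ : Set where
    old : Vertex → Vertex⁺
    new : ∀ {u v} → value (label v) ≡ + n → Path u v → Vertex⁺

  data _⟶⁺_ : Rel Vertex⁺ 0ℓ where
    old : ∀ {u v} → u ⟶ v → old u ⟶⁺ old v
    new : ∀ {u v} (ℓ : value (label v) ≡ + n) (π : Path u v) →
          old u ⟶⁺ new ℓ π

  label⁺ : Vertex⁺ → Label k
  label⁺ (old v)   = label v
  label⁺ (new _ _) = mkLabel (+ suc n) ℤₚ.neg-≤-pos

  irreflexive⁺ : Irreflexive _≡_ _⟶⁺_
  irreflexive⁺ refl (old e) = irreflexive refl e

  irrelevant⁺ : Irrelevant _⟶⁺_
  irrelevant⁺ (old e)   (old e′)  = cong old (irrelevant e e′)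
  irrelevant⁺ (new _ _) (new _ _) = refl

  adjoin : LabeledGraph (Label k)
  adjoin = record
    { graph = record
      { Vertex      = Vertex⁺
      ; _⟶_         = _⟶⁺_
      ; irreflexive = irreflexive⁺
      ; irrelevant  = irrelevant⁺
      }
    ; label = label⁺
    }

open Adjoin public using (old; new)

A : (k n : ℕ) → LabeledGraph (Label k)
A k zero    = linear k
A k (suc n) = Adjoin.adjoin (A k n) n

module A (k n : ℕ) = LabeledGraph (A k n)

-- The vertex labeled -k.
root : (k n : ℕ) → A.Vertex k n
root k zero    = zero
root k (suc n) = old (root k n)

-- Leaves are to be compared by their underlying vertices (_≡_ on proj₁):
-- the proof of IsLeaf carries functions and is not part of the data.
Leaf : (k n : ℕ) → Set
Leaf k n = Σ[ v ∈ A.Vertex k n ] A.IsLeaf k n (root k n) v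

------------------------------------------------------------------------
-- Planar rooted forests

-- Children are listed from left to right.
data Tree (X : Set) : Set where
  node : X → List (Tree X) → Tree X

PlanarTree : Set
PlanarTree = Tree ⊤

module _ {X : Set} where

  rootLabel : Tree X → X
  rootLabel (node x _) = x

  edges    : Tree X → ℕ
  vertices : List (Tree X) → ℕ
  edges (node _ ts) = vertices ts
  vertices []       = 0
  vertices (t ∷ ts) = suc (edges t) + vertices ts

Forest : (k n : ℕ) → Set
Forest k n = Σ[ f ∈ Vec PlanarTree (suc k) ] Vec.sum (Vec.map edges f) ≡ n

-- number m t (resp. numberAll m ts) labels t (resp. the sibling trees ts)
-- depth first and from right to left, with m as the first label used.
number    : ℕ → PlanarTree → Tree ℤ
numberAll : ℕ → List PlanarTree → List (Tree ℤ)
number m (node _ ts) = node (+ m) (numberAll (suc m) ts)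
numberAll m []       = []
numberAll m (t ∷ ts) = number (m + vertices ts) t ∷ numberAll m ts

-- The canonical labeling.  A root with j trees to its right is labeled -j;
-- the non-root vertices of those trees use up the labels 1 , … , edges.
canonical : ∀ {j} → Vec PlanarTree j → Vec (Tree ℤ) j
canonical []                      = []
canonical {suc j} (node _ ts ∷ f) =
  node (- (+ j)) (numberAll (suc (Vec.sum (Vec.map edges f))) ts) ∷ canonical f

-- In the given tree, some vertex labeled p is the parent of a vertex
-- labeled c.
data ParentIn (p c : ℤ) : Tree ℤ → Set where
  here  : ∀ {ts} → Any (λ t → rootLabel t ≡ c) ts → ParentIn p c (node p ts)
  there : ∀ {q ts} → Any (ParentIn p c) ts → ParentIn p c (node q ts)

-- Removal of the non-root vertex labeled c.  A vertex is removed together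
-- with its descendants, but this is only ever applied to the last vertex in
-- the canonical labeling, which has none.
delete    : ℤ → Tree ℤ → Tree ℤ
deleteAll : ℤ → List (Tree ℤ) → List (Tree ℤ)
delete c (node x ts) = node x (deleteAll c ts)
deleteAll c []       = []
deleteAll c (t ∷ ts) =
  if does (rootLabel t ℤ.≟ c) then deleteAll c ts
  else delete c t ∷ deleteAll c ts

erase    : ∀ {X} → Tree X → PlanarTree
eraseAll : ∀ {X} → List (Tree X) → List PlanarTree
erase (node _ ts) = node tt (eraseAll ts)
eraseAll []       = []
eraseAll (t ∷ ts) = erase t ∷ eraseAll ts

-- The label of the parent, in F, of the vertex labeled c is p.
ParentLabel : ∀ {k n} → Forest k n → (c p : ℤ) → Set
ParentLabel F c p = VecAny.Any (ParentIn p c) (canonical (proj₁ F))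

deleteVertex : ∀ {k n} → ℤ → Forest k n → Vec PlanarTree (suc k)
deleteVertex c F = Vec.map (λ t → erase (delete c t)) (canonical (proj₁ F))

------------------------------------------------------------------------
-- The assembly procedure

-- F ⇝ v: the procedure Φᵏₙ sends F to v.  The procedure is given by its
-- graph, because its being well defined (existence and uniqueness of v)
-- is not evident.  In step, σ followed by π is the directed path from the
-- root to v′, on which u is the vertex labeled p.
infix 4 _⇝_

data _⇝_ {k : ℕ} : ∀ {n} → Forest k n → A.Vertex k n → Set where
  base : {F : Forest k 0} {v : A.Vertex k 0} →
         value (A.label k 0 v) ≡ + 0 →
         F ⇝ v
  step : ∀ {n} {F : Forest k (suc n)} {F′ : Forest k n} {p : ℤ}
         {u v′ : A.Vertex k n} →
         ParentLabel F (+ suc n) p →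
         proj₁ F′ ≡ deleteVertex (+ suc n) F →
         F′ ⇝ v′ →
         (ℓ : value (A.label k n v′) ≡ + n) →
         (σ : A.Path k n (root k n) u) →
         value (A.label k n u) ≡ p →
         (π : A.Path k n u v′) →
         F ⇝ new ℓ π

{-# OPTIONS --safe #-}
module Submission where

open import Defs
open import Axiom.UniquenessOfIdentityProofs.WithK using (uip)
open import Data.Fin as Fin using (Fin; toℕ; fromℕ; fromℕ<)
import Data.Fin.Properties as Finₚ
open import Data.Integer as ℤ using (ℤ; +_; -_; _⊖_)
import Data.Integer.Properties as ℤₚ
open import Data.List using (List; []; _∷_)
open import Data.List.Relation.Unary.All using (All; []; _∷_)
open import Data.List.Relation.Unary.Any using (Any; here; there)
open import Data.Nat using (ℕ; zero; suc; _+_; _∸_; _≤_; _<_; z≤n; s≤s)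
import Data.Nat.Properties as ℕₚ
open import Data.Product using (Σ-syntax; ∃-syntax; _×_; _,_; proj₁; proj₂)
open import Data.Sum as Sum using (_⊎_; inj₁; inj₂)
open import Data.Unit using (tt)
open import Data.Vec as Vec using (Vec; []; _∷_)
import Data.Vec.Properties as Vecₚ
import Data.Vec.Relation.Unary.All as VecAll
open VecAll using ([]; _∷_)
import Data.Vec.Relation.Unary.Any as VecAny
open VecAny using (here; there)
open import Function
  using (_on_; _∘_; _⇔_; Bijective; Inverse; Equivalence; mk⇔; mk↔ₛ′)
open import Relation.Binary.Construct.Closure.ReflexiveTransitive
  using (ε; _◅_; _◅◅_; gmap)
open import Relation.Binary.PropositionalEquality
  using (_≡_; _≢_; refl; sym; trans; cong; cong₂; subst; module ≡-Reasoning)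
open import Relation.Nullary using (¬_; contradiction; yes; no)

-- The vertex labeled n of a forest with n edges ends its left spine: the roots
-- up to the leftmost tree with an edge, followed by the first children in that
-- tree.  A forest with n + 1 edges is a forest F′ with n edges together with a
-- vertex on its left spine, below which the vertex n + 1 is grafted as first
-- child.  Labels increase along the spine, and grafting below p replaces the
-- part of the spine after p by n + 1.  In the action graph, a vertex labeled
-- n + 1 is a vertex v′ labeled n together with a path into v′; as every vertex
-- has at most one incoming edge and labels increase along edges, this path is
-- determined by the label p of its source, and passing to the new vertex
-- replaces the ancestors of v′ after p by n + 1.  Hence the labels on the left
-- spine of F are the labels of the ancestors of Φ F, and both sides make the
-- same choices at each step.

-- Arborescences with increasing labels

module _ {k : ℕ} (G : LabeledGraph (Label k)) where
  open LabeledGraph G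

  -- Increasing labels exclude cycles, so the fields describe a tree directed away from `r`. In this
  -- form each field can be carried through `adjoin`.
  record IsArborescence (r : Vertex) : Set where
    field
      increasing : ∀ {u v} → u ⟶ v → value (label u) ℤ.< value (label v)
      one-source : ∀ {u v w} → u ⟶ w → v ⟶ w → u ≡ v
      reachable  : ∀ v → Path r v

module Arborescence {k : ℕ} (G : LabeledGraph (Label k)) {r : LabeledGraph.Vertex G}
                    (arborescence : IsArborescence G r) where
  open LabeledGraph G
  open IsArborescence arborescence

  path-≤ : ∀ {u v} → Path u v → value (label u) ℤ.≤ value (label v)
  path-≤ ε       = ℤₚ.≤-refl
  path-≤ (e ◅ π) = ℤₚ.≤-trans (ℤₚ.<⇒≤ (increasing e)) (path-≤ π)

  nonempty-< : ∀ {u v w} → u ⟶ v → Path v w → value (label u) ℤ.< value (label w)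
  nonempty-< e π = ℤₚ.<-≤-trans (increasing e) (path-≤ π)

  last-edge : ∀ {u v w} → u ⟶ v → Path v w → ∃[ x ] Path u x × x ⟶ w
  last-edge e ε        = _ , ε , e
  last-edge e (e′ ◅ π) with last-edge e′ π
  ... | x , ρ , d = x , e ◅ ρ , d

  -- Sources of edges are unique, so two paths into `w` agree backwards from `w` until the shorter
  -- one is exhausted.
  comparable : ∀ {u v w} → Path u w → Path v w → Path u v ⊎ Path v u
  comparable ε       ρ = inj₂ ρ
  comparable (e ◅ π) ρ with comparable π ρ
  ... | inj₁ σ        = inj₁ (e ◅ σ)
  ... | inj₂ ε        = inj₁ (e ◅ ε)
  ... | inj₂ (d ◅ σ) with last-edge d σ
  ...   | _ , σ′ , e′ with one-source e e′
  ...     | refl = inj₂ σ′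

  path-back : ∀ {u v w} → Path u w → Path v w →
              value (label u) ℤ.≤ value (label v) → Path u v
  path-back π ρ u≤v with comparable π ρ
  ... | inj₁ σ       = σ
  ... | inj₂ ε       = ε
  ... | inj₂ (d ◅ σ) = contradiction u≤v (ℤₚ.<⇒≱ (nonempty-< d σ))

  -- One of the two ancestors of `w` reaches the other, and labels grow strictly on the way. Hence
  -- the parent label in `step` names at most one starting vertex.
  label-injective : ∀ {u v w} → Path u w → Path v w →
                    value (label u) ≡ value (label v) → u ≡ v
  label-injective π ρ eq with path-back π ρ (ℤₚ.≤-reflexive eq)
  ... | ε     = refl
  ... | d ◅ σ = contradiction eq (ℤₚ.<⇒≢ (nonempty-< d σ))

  sibling-path : ∀ {u v w} → u ⟶ v → u ⟶ w → Path v w → v ≡ w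
  sibling-path e e′ ε = refl
  sibling-path e e′ (d ◅ σ) with last-edge d σ
  ... | _ , σ′ , e″ with one-source e′ e″
  ...   | refl = contradiction (path-≤ σ′) (ℤₚ.<⇒≱ (increasing e))

  comparable-siblings : ∀ {u v w} → u ⟶ v → u ⟶ w → Path v w ⊎ Path w v → v ≡ w
  comparable-siblings e e′ (inj₁ σ) = sibling-path e e′ σ
  comparable-siblings e e′ (inj₂ σ) = sym (sibling-path e′ e σ)

  -- The first edges lead to comparable siblings, which coincide: a nonempty path between siblings
  -- would return to their parent. This matters because the vertices `new ℓ π` are indexed by paths.
  path-irrelevant : ∀ {u v} (π ρ : Path u v) → π ≡ ρ
  path-irrelevant ε       ε       = refl
  path-irrelevant ε       (e ◅ ρ) = contradiction refl (ℤₚ.<⇒≢ (nonempty-< e ρ))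
  path-irrelevant (e ◅ π) ε       = contradiction refl (ℤₚ.<⇒≢ (nonempty-< e π))
  path-irrelevant (e ◅ π) (e′ ◅ ρ)
    with comparable-siblings e e′ (comparable π ρ)
  ... | refl = cong₂ _◅_ (irrelevant e e′) (path-irrelevant π ρ)

  -- A childless root is the whole graph, as everything is reachable from it. Any other childless
  -- vertex has only its incoming edge.
  childless⇒leaf : ∀ {v} → (∀ {w} → ¬ v ⟶ w) → IsLeaf r v
  childless⇒leaf {v} childless with reachable v
  ... | ε = inj₂ (refl , λ w → alone (reachable w))
    where
    alone : ∀ {w} → Path v w → w ≡ v
    alone ε       = refl
    alone (e ◅ _) = contradiction e childless
  ... | d ◅ σ with last-edge d σ
  ...   | u , _ , e =
    inj₁ ((λ { refl → childless d })
        , mk↔ₛ′ (λ _ → Fin.zero) (λ _ → u , inj₂ e) only unique)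
    where
    only : (i : Fin 1) → Fin.zero ≡ i
    only Fin.zero = refl
    unique : (i : IncidentEdge v) → (u , inj₂ e) ≡ i
    unique (w , inj₁ e′) = contradiction e′ childless
    unique (w , inj₂ e′) with one-source e e′
    ... | refl = cong (λ d → u , inj₂ d) (irrelevant e e′)

  leaf⇒childless : ∀ {v} → IsLeaf r v → ∀ {w} → ¬ v ⟶ w
  leaf⇒childless (inj₂ (refl , alone)) {w} e = irreflexive (sym (alone w)) e
  leaf⇒childless {v} (inj₁ (v≢r , valence)) {w} e with reachable v
  ... | ε     = v≢r refl
  ... | d ◅ σ with last-edge d σ
  -- Valence 1 would identify the outgoing edge `e` with the incoming edge `e′`.
  ...   | u , _ , e′ = absurd (trans (sym (strictlyInverseʳ (w , inj₁ e)))
                          (trans (cong from (only (to (w , inj₁ e)) (to (u , inj₂ e′))))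
                                 (strictlyInverseʳ (u , inj₂ e′))))
    where
    open Inverse valence
    only : (i j : Fin 1) → i ≡ j
    only Fin.zero Fin.zero = refl
    absurd : ¬ ((w , inj₁ e) ≡ (u , inj₂ e′))
    absurd ()

-- The action graphs are arborescences

linear-path : ∀ {k} d {i j : Fin (suc k)} → d + toℕ i ≡ toℕ j →
              LabeledGraph.Path (linear k) i j
linear-path zero eq with Finₚ.toℕ-injective eq
... | refl = ε
linear-path {k} (suc d) {i} {j} eq =
  sym step≡ ◅ linear-path d (trans (cong (_+_ d) (sym step≡)) (trans (ℕₚ.+-suc d (toℕ i)) eq))
  where
  i<k : suc (toℕ i) < suc k
  i<k = ℕₚ.≤-<-trans (ℕₚ.≤-trans (s≤s (ℕₚ.m≤n+m (toℕ i) d)) (ℕₚ.≤-reflexive eq)) (Finₚ.toℕ<n j)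
  step≡ : suc (toℕ i) ≡ toℕ (fromℕ< i<k)
  step≡ = sym (Finₚ.toℕ-fromℕ< i<k)

linear-isArborescence : ∀ k → IsArborescence (linear k) Fin.zero
linear-isArborescence k = record
  { increasing = λ {i} {j} eq → ℤₚ.⊖-monoˡ-< k (ℕₚ.≤-reflexive (sym eq))
  ; one-source = λ e e′ → Finₚ.toℕ-injective (ℕₚ.suc-injective (trans (sym e) e′))
  ; reachable  = λ j → linear-path (toℕ j) (ℕₚ.+-identityʳ (toℕ j))
  }

module _ {k : ℕ} {G : LabeledGraph (Label k)} {r : LabeledGraph.Vertex G} {n : ℕ}
         (arborescence : IsArborescence G r)
         (label≤ : ∀ v → value (LabeledGraph.label G v) ℤ.≤ + n) where
  open IsArborescence arborescence

  -- New edges are increasing because `label≤` bounds the label of their source by `n`. A new vertex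
  -- contains its path, and with it the source of its only incoming edge.
  adjoin-isArborescence : IsArborescence (Adjoin.adjoin G n) (old r)
  adjoin-isArborescence = record
    { increasing = increasing⁺ ; one-source = one-source⁺ ; reachable = reachable⁺ }
    where
    open LabeledGraph (Adjoin.adjoin G n)

    increasing⁺ : ∀ {u v} → u ⟶ v → value (label u) ℤ.< value (label v)
    increasing⁺ (old e)       = increasing e
    increasing⁺ (new {u} _ _) = ℤₚ.≤-<-trans (label≤ u) (ℤ.+<+ (ℕₚ.n<1+n n))

    one-source⁺ : ∀ {u v w} → u ⟶ w → v ⟶ w → u ≡ v
    one-source⁺ (old e)   (old e′)  = cong old (one-source e e′)
    one-source⁺ (new ℓ π) (new _ _) = refl

    reachable⁺ : ∀ v → Path (old r) v
    reachable⁺ (old v)       = gmap old old (reachable v)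
    reachable⁺ (new {u} ℓ π) = gmap old old (reachable u) ◅◅ (new ℓ π ◅ ε)

  label≤⁺ : ∀ v → value (LabeledGraph.label (Adjoin.adjoin G n) v) ℤ.≤ + suc n
  label≤⁺ (old v)   = ℤₚ.≤-trans (label≤ v) (ℤ.+≤+ (ℕₚ.n≤1+n n))
  label≤⁺ (new _ _) = ℤₚ.≤-refl

A-label≤ : ∀ k n v → value (A.label k n v) ℤ.≤ + n
A-isArborescence : ∀ k n → IsArborescence (A k n) (root k n)

A-label≤ k zero i    = subst (toℕ i ⊖ k ℤ.≤_) (ℤₚ.n⊖n≡0 k) (ℤₚ.⊖-monoˡ-≤ k (Finₚ.toℕ≤pred[n] i))
A-label≤ k (suc n) = label≤⁺ (A-isArborescence k n) (A-label≤ k n)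

A-isArborescence k zero    = linear-isArborescence k
A-isArborescence k (suc n) = adjoin-isArborescence (A-isArborescence k n) (A-label≤ k n)

module ActionGraph (k n : ℕ) where
  open Arborescence (A k n) (A-isArborescence k n) public
  open IsArborescence (A-isArborescence k n) public

-- Leaves and the label `n`

linear-label-0 : ∀ {k} {i : Fin (suc k)} → toℕ i ⊖ k ≡ + 0 → i ≡ fromℕ k
linear-label-0 {k} {i} eq = Finₚ.toℕ-injective (trans (ℕₚ.≤-antisym i≤k k≤i) (sym (Finₚ.toℕ-fromℕ k)))
  where
  i≤k = Finₚ.toℕ≤pred[n] i
  k≤i : k ≤ toℕ i
  k≤i = ℕₚ.m∸n≡0⇒m≤n (ℤₚ.+-injective (ℤₚ.neg-injective {+ (k ∸ toℕ i)} {+ 0} (trans (sym (ℤₚ.⊖-≤ i≤k)) eq)))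

A-child : ∀ k n v → value (A.label k n v) ≡ + n ⊎ ∃[ w ] (A._⟶_ k n v w)
A-child k zero i with ℕₚ.m≤n⇒m<n∨m≡n (Finₚ.toℕ≤pred[n] i)
... | inj₁ i<k = inj₂ (fromℕ< (s≤s i<k) , Finₚ.toℕ-fromℕ< (s≤s i<k))
... | inj₂ i≡k = inj₁ (trans (cong (_⊖ k) i≡k) (ℤₚ.n⊖n≡0 k))
A-child k (suc n) (new ℓ π) = inj₁ refl
A-child k (suc n) (old v) with A-child k n v
-- The trivial path alone gives each vertex labeled `n` a child at the next stage.
... | inj₁ ℓ       = inj₂ (new ℓ ε , new ℓ ε)
... | inj₂ (w , e) = inj₂ (old w , old e)

leaf-label : ∀ k n {v} → A.IsLeaf k n (root k n) v → value (A.label k n v) ≡ + n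
leaf-label k n {v} leaf with A-child k n v
... | inj₁ ℓ       = ℓ
... | inj₂ (_ , e) = contradiction e (ActionGraph.leaf⇒childless k n leaf)

label-leaf : ∀ k n {v} → value (A.label k n v) ≡ + n → A.IsLeaf k n (root k n) v
label-leaf k n {v} ℓ = childless⇒leaf λ {w} e →
  ℤₚ.<⇒≱ (increasing e) (ℤₚ.≤-trans (A-label≤ k n w) (ℤₚ.≤-reflexive (sym ℓ)))
  where open ActionGraph k n

-- Left spines
variable
  p q c x : ℤ
  j m : ℕ
  t : Tree ℤ
  ts : List (Tree ℤ)
  f : Vec (Tree ℤ) j

data Spine (p : ℤ) : Tree ℤ → Set where
  here : Spine p (node p ts)
  down : Spine p t → Spine p (node x (t ∷ ts))

graft : ℤ → Spine p t → Tree ℤ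
graft {p} c (here {ts = ts})           = node p (node c [] ∷ ts)
graft     c (down {x = x} {ts = ts} s) = node x (graft c s ∷ ts)

-- `next` passes bare roots only: trees are numbered from right to left, so a vertex grafted to the
-- right of a tree with edges would not receive the last label.
data ForestSpine (p : ℤ) : Vec (Tree ℤ) j → Set where
  stay : Spine p t → ForestSpine p (t ∷ f)
  next : ForestSpine p f → ForestSpine p (node x [] ∷ f)

graftForest : {f : Vec (Tree ℤ) j} → ℤ → ForestSpine p f → Vec (Tree ℤ) j
graftForest c (stay {f = f} s) = graft c s ∷ f
graftForest c (next {x = x} s) = node x [] ∷ graftForest c s

rootLabel-graft : (s : Spine p t) → rootLabel (graft c s) ≡ rootLabel t
rootLabel-graft here     = refl
rootLabel-graft (down _) = refl

-- The label of the root itself is not constrained, as it is not inspected by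
-- delete or, as a child, by ParentIn.
data Absent (c : ℤ) : Tree ℤ → Set where
  node : All (λ t → rootLabel t ≢ c × Absent c t) ts → Absent c (node x ts)

AbsentAll : ℤ → List (Tree ℤ) → Set
AbsentAll c = All (λ t → rootLabel t ≢ c × Absent c t)

absent⇒¬child : AbsentAll c ts → ¬ Any (λ t → rootLabel t ≡ c) ts
absent⇒¬child ((t≢c , _) ∷ _) (here t≡c) = t≢c t≡c
absent⇒¬child (_ ∷ as)        (there i)  = absent⇒¬child as i

absent⇒¬parent    : Absent c t → ¬ ParentIn q c t
absent⇒¬parentAll : AbsentAll c ts → ¬ Any (ParentIn q c) ts
absent⇒¬parent (node as) (here i)  = absent⇒¬child as i
absent⇒¬parent (node as) (there i) = absent⇒¬parentAll as i
absent⇒¬parentAll ((_ , a) ∷ _) (here i)  = absent⇒¬parent a i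
absent⇒¬parentAll (_ ∷ as)      (there i) = absent⇒¬parentAll as i

parent-graft : (s : Spine p t) → ParentIn p c (graft c s)
parent-graft here     = here (here refl)
parent-graft (down s) = there (here (parent-graft s))

-- No vertex of `t` below the root is labeled `c`, so the grafted vertex is the only child with that
-- label.
parent-graft-unique : Absent c t → (s : Spine p t) → ParentIn q c (graft c s) → q ≡ p
parent-graft-unique (node as) here (here _) = refl
parent-graft-unique (node as) here (there (here (here ())))
parent-graft-unique (node as) here (there (here (there ())))
parent-graft-unique (node as) here (there (there i)) = contradiction i (absent⇒¬parentAll as)
parent-graft-unique (node ((t≢c , _) ∷ _)) (down s) (here (here t≡c)) =
  contradiction (trans (sym (rootLabel-graft s)) t≡c) t≢c
parent-graft-unique (node (_ ∷ as)) (down s) (here (there i)) = contradiction i (absent⇒¬child as)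
parent-graft-unique (node ((_ , a) ∷ _)) (down s) (there (here i)) = parent-graft-unique a s i
parent-graft-unique (node (_ ∷ as)) (down s) (there (there i)) = contradiction i (absent⇒¬parentAll as)

deleteAll-root : rootLabel t ≡ c → deleteAll c (t ∷ ts) ≡ deleteAll c ts
deleteAll-root {t} {c} t≡c with rootLabel t ℤ.≟ c
... | yes _  = refl
... | no t≢c = contradiction t≡c t≢c

deleteAll-nonroot : rootLabel t ≢ c → deleteAll c (t ∷ ts) ≡ delete c t ∷ deleteAll c ts
deleteAll-nonroot {t} {c} t≢c with rootLabel t ℤ.≟ c
... | yes t≡c = contradiction t≡c t≢c
... | no _    = refl

delete-absent    : Absent c t → delete c t ≡ t
deleteAll-absent : AbsentAll c ts → deleteAll c ts ≡ ts
delete-absent (node as) = cong (node _) (deleteAll-absent as)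
deleteAll-absent []               = refl
deleteAll-absent {ts = t ∷ ts} ((t≢c , a) ∷ as) =
  trans (deleteAll-nonroot {t = t} {ts = ts} t≢c) (cong₂ _∷_ (delete-absent a) (deleteAll-absent as))

delete-graft : Absent c t → (s : Spine p t) → delete c (graft c s) ≡ t
delete-graft {c} (node {ts = ts} as) here =
  cong (node _) (trans (deleteAll-root {t = node c []} {ts = ts} refl) (deleteAll-absent as))
delete-graft (node ((t≢c , a) ∷ as)) (down {ts = ts} s) =
  cong (node _) (trans (deleteAll-nonroot {t = graft _ s} {ts = ts} (t≢c ∘ trans (sym (rootLabel-graft s))))
                       (cong₂ _∷_ (delete-graft a s) (deleteAll-absent as)))

parent-graftForest : (s : ForestSpine p f) → VecAny.Any (ParentIn p c) (graftForest c s)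
parent-graftForest (stay s) = here (parent-graft s)
parent-graftForest (next s) = there (parent-graftForest s)

absent⇒¬parentForest : VecAll.All (Absent c) f → ¬ VecAny.Any (ParentIn q c) f
absent⇒¬parentForest (a ∷ _)  (here i)  = absent⇒¬parent a i
absent⇒¬parentForest (_ ∷ as) (there i) = absent⇒¬parentForest as i

parent-graftForest-unique : VecAll.All (Absent c) f → (s : ForestSpine p f) →
                            VecAny.Any (ParentIn q c) (graftForest c s) → q ≡ p
parent-graftForest-unique (a ∷ as) (stay s) (here i)  = parent-graft-unique a s i
parent-graftForest-unique (a ∷ as) (stay s) (there i) = contradiction i (absent⇒¬parentForest as)
parent-graftForest-unique (a ∷ as) (next s) (here i)  = contradiction i (absent⇒¬parent a)
parent-graftForest-unique (a ∷ as) (next s) (there i) = parent-graftForest-unique as s i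

delete-absentForest : VecAll.All (Absent c) f → Vec.map (delete c) f ≡ f
delete-absentForest []       = refl
delete-absentForest (a ∷ as) = cong₂ _∷_ (delete-absent a) (delete-absentForest as)

delete-graftForest : VecAll.All (Absent c) f → (s : ForestSpine p f) →
                     Vec.map (delete c) (graftForest c s) ≡ f
delete-graftForest (a ∷ as) (stay s) = cong₂ _∷_ (delete-graft a s) (delete-absentForest as)
delete-graftForest (a ∷ as) (next s) = cong (_ ∷_) (delete-graftForest as s)

-- Increasing labels along the spine

-- Only first children are compared with their parents, as the condition concerns the left spine.
data Increasing : Tree ℤ → Set where
  leaf : Increasing (node x [])
  node : x ℤ.< rootLabel t → Increasing t → Increasing (node x (t ∷ ts))

data IncreasingForest : Vec (Tree ℤ) j → Set where
  []  : IncreasingForest []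
  _∷_ : Increasing t × (∀ {q} → ForestSpine q f → rootLabel t ℤ.< q) →
        IncreasingForest f → IncreasingForest (t ∷ f)

root≤spine : Increasing t → Spine q t → rootLabel t ℤ.≤ q
root≤spine i here                = ℤₚ.≤-refl
root≤spine (node x<t i) (down s) = ℤₚ.≤-trans (ℤₚ.<⇒≤ x<t) (root≤spine i s)

root<down : x ℤ.< rootLabel t → Increasing t → Spine q t → x ℤ.< q
root<down x<t i s = ℤₚ.<-≤-trans x<t (root≤spine i s)

-- Distinct positions on the spine have distinct labels, so the label of the parent determines where
-- to graft.
spine-unique : Increasing t → (s s′ : Spine p t) → s ≡ s′
spine-unique i here here = refl
spine-unique (node x<t i) here (down s) = contradiction refl (ℤₚ.<⇒≢ (root<down x<t i s))
spine-unique (node x<t i) (down s) here = contradiction refl (ℤₚ.<⇒≢ (root<down x<t i s))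
spine-unique (node x<t i) (down s) (down s′) = cong down (spine-unique i s s′)

forestSpine-unique : IncreasingForest f → (s s′ : ForestSpine p f) → s ≡ s′
forestSpine-unique ((i , _) ∷ _) (stay s) (stay s′)      = cong stay (spine-unique i s s′)
forestSpine-unique ((_ , x<) ∷ _) (stay here) (next s′)  = contradiction refl (ℤₚ.<⇒≢ (x< s′))
forestSpine-unique ((_ , x<) ∷ _) (next s) (stay here)   = contradiction refl (ℤₚ.<⇒≢ (x< s))
forestSpine-unique (_ ∷ is) (next s) (next s′)           = cong next (forestSpine-unique is s s′)

-- The grafted vertex is a childless first child, so it ends the new spine and cuts off what
-- followed `p`. Together with `spine-graft-new` and `spine-graft-old` this determines the new
-- spine.
spine-graft⁻ : Increasing t → (s : Spine p t) → Spine q (graft c s) →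
               q ≡ c ⊎ Spine q t × q ℤ.≤ p
spine-graft⁻ i here here            = inj₂ (here , ℤₚ.≤-refl)
spine-graft⁻ i here (down here)     = inj₁ refl
spine-graft⁻ i (down s) here        = inj₂ (here , root≤spine i (down s))
spine-graft⁻ (node _ i) (down s) (down r) =
  Sum.map₂ (λ (r , q≤p) → down r , q≤p) (spine-graft⁻ i s r)

spine-graft-new : (s : Spine p t) → Spine c (graft c s)
spine-graft-new here     = down here
spine-graft-new (down s) = down (spine-graft-new s)

spine-graft-old : Increasing t → (s : Spine p t) → Spine q t → q ℤ.≤ p → Spine q (graft c s)
spine-graft-old i here here q≤p = here
spine-graft-old (node x<t i) here (down r) q≤p = contradiction q≤p (ℤₚ.<⇒≱ (root<down x<t i r))
spine-graft-old i (down s) here q≤p = here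
spine-graft-old (node _ i) (down s) (down r) q≤p = down (spine-graft-old i s r q≤p)

forestSpine-graft⁻ : IncreasingForest f → (s : ForestSpine p f) → ForestSpine q (graftForest c s) →
                     q ≡ c ⊎ ForestSpine q f × q ℤ.≤ p
-- The cases of s are split so that Agda sees that the root of the graft has a
-- child, which excludes next.
forestSpine-graft⁻ ((i , _) ∷ _) (stay here) (stay r) =
  Sum.map₂ (λ (r , q≤p) → stay r , q≤p) (spine-graft⁻ i here r)
forestSpine-graft⁻ ((i , _) ∷ _) (stay (down s)) (stay r) =
  Sum.map₂ (λ (r , q≤p) → stay r , q≤p) (spine-graft⁻ i (down s) r)
forestSpine-graft⁻ ((_ , x<) ∷ _) (next s) (stay here) = inj₂ (stay here , ℤₚ.<⇒≤ (x< s))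
forestSpine-graft⁻ (_ ∷ is) (next s) (next r) =
  Sum.map₂ (λ (r , q≤p) → next r , q≤p) (forestSpine-graft⁻ is s r)

forestSpine-graft-new : (s : ForestSpine p f) → ForestSpine c (graftForest c s)
forestSpine-graft-new (stay s) = stay (spine-graft-new s)
forestSpine-graft-new (next s) = next (forestSpine-graft-new s)

forestSpine-graft-old : IncreasingForest f → (s : ForestSpine p f) → ForestSpine q f → q ℤ.≤ p →
                        ForestSpine q (graftForest c s)
forestSpine-graft-old ((i , _) ∷ _) (stay s) (stay r) q≤p = stay (spine-graft-old i s r q≤p)
forestSpine-graft-old ((_ , x<) ∷ _) (stay here) (next r) q≤p = contradiction q≤p (ℤₚ.<⇒≱ (x< r))
forestSpine-graft-old _ (next s) (stay here) q≤p = stay here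
forestSpine-graft-old (_ ∷ is) (next s) (next r) q≤p = next (forestSpine-graft-old is s r q≤p)

-- Canonical labeling
number-shift : ∀ m v u → suc (m + v) + u ≡ m + (suc u + v)
number-shift m v u = trans (cong suc (trans (ℕₚ.+-assoc m v u) (cong (_+_ m) (ℕₚ.+-comm v u))))
                           (sym (ℕₚ.+-suc m (u + v)))

-- The labels used start at `m` and stay below `m + vertices us`.
numberAll-absent : ∀ {m c} us → m + vertices us ≤ c → AbsentAll (+ c) (numberAll m us)
numberAll-absent [] le = []
numberAll-absent {m} {c} (node _ vs ∷ us) le =
  ((λ eq → ℕₚ.<⇒≢ (ℕₚ.≤-trans (s≤s (ℕₚ.m≤m+n _ _)) le′) (ℤₚ.+-injective eq))
    , node (numberAll-absent vs le′))
  ∷ numberAll-absent us (ℕₚ.≤-trans (ℕₚ.n≤1+n _) (ℕₚ.≤-trans (ℕₚ.m≤m+n _ _) le′))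
  where
  le′ : suc (m + vertices us) + vertices vs ≤ c
  le′ = ℕₚ.≤-trans (ℕₚ.≤-reflexive (number-shift m (vertices us) (vertices vs))) le

forestEdges : Vec PlanarTree j → ℕ
forestEdges f = Vec.sum (Vec.map edges f)

canonical-absent : ∀ (f : Vec PlanarTree j) {n} → forestEdges f ≤ n →
                   VecAll.All (Absent (+ suc n)) (canonical f)
canonical-absent [] le = []
canonical-absent (node _ us ∷ f) le =
  node (numberAll-absent us (s≤s (ℕₚ.≤-trans (ℕₚ.≤-reflexive (ℕₚ.+-comm (forestEdges f) (vertices us))) le)))
  ∷ canonical-absent f (ℕₚ.≤-trans (ℕₚ.m≤n+m _ (vertices us)) le)

numberAll-increasing : ∀ us → x ℤ.< + m → Increasing (node x (numberAll m us))
numberAll-increasing [] x<m = leaf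
numberAll-increasing {m = m} (node _ vs ∷ us) x<m =
  node (ℤₚ.<-≤-trans x<m (ℤ.+≤+ (ℕₚ.m≤m+n m _)))
       (numberAll-increasing vs (ℤ.+<+ (ℕₚ.n<1+n _)))

-j<+ : ∀ j {n} → - (+ j) ℤ.< + suc n
-j<+ j = ℤₚ.≤-<-trans (ℤₚ.neg-≤-pos {j} {0}) (ℤ.+<+ (s≤s z≤n))

canonical-increasing : ∀ (f : Vec PlanarTree j) → IncreasingForest (canonical f)
-- The `j` roots are labeled from `1 - j` to `0`, and all other labels are positive.
canonical-spine> : ∀ (f : Vec PlanarTree j) → ForestSpine q (canonical f) → - (+ j) ℤ.< q
canonical-increasing [] = []
canonical-increasing {j = suc j} (node _ us ∷ f) =
  (numberAll-increasing us (-j<+ j) , canonical-spine> f) ∷ canonical-increasing f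
canonical-spine> {j = suc j} (node _ [] ∷ f) (stay here) = ℤₚ.neg-mono-< (ℤ.+<+ (ℕₚ.n<1+n j))
canonical-spine> {j = suc j} (node _ us@(_ ∷ _) ∷ f) (stay s) =
  ℤₚ.<-≤-trans (ℤₚ.neg-mono-< (ℤ.+<+ (ℕₚ.n<1+n j))) (root≤spine (numberAll-increasing us (-j<+ j)) s)
canonical-spine> {j = suc j} (node _ [] ∷ f) (next s) =
  ℤₚ.<-trans (ℤₚ.neg-mono-< (ℤ.+<+ (ℕₚ.n<1+n j))) (canonical-spine> f s)

erase-number    : ∀ m u → erase (number m u) ≡ u
erase-numberAll : ∀ m us → eraseAll (numberAll m us) ≡ us
erase-number m (node _ us) = cong (node tt) (erase-numberAll (suc m) us)
erase-numberAll m []       = refl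
erase-numberAll m (u ∷ us) = cong₂ _∷_ (erase-number (m + vertices us) u) (erase-numberAll m us)

erase-canonical : (f : Vec PlanarTree j) → Vec.map erase (canonical f) ≡ f
erase-canonical []              = refl
erase-canonical (node _ us ∷ f) = cong₂ _∷_ (cong (node tt) (erase-numberAll _ us)) (erase-canonical f)

canonical-injective : {f g : Vec PlanarTree j} → canonical f ≡ canonical g → f ≡ g
canonical-injective {f = f} {g} eq =
  trans (sym (erase-canonical f)) (trans (cong (Vec.map erase) eq) (erase-canonical g))

-- Removing and grafting the last vertex

-- Among siblings the first is numbered last, so the largest label `c` is found by descending
-- through first children until one is childless.
ungraft : ∀ x m u us {c} → m + vertices (u ∷ us) ≡ suc c →
          ∃[ vs ] m + vertices vs ≡ c ×
          ∃[ p ] Σ[ s ∈ Spine p (node x (numberAll m vs)) ]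
          node x (numberAll m (u ∷ us)) ≡ graft (+ c) s
ungraft x m (node _ []) us eq with ℕₚ.suc-injective (trans (sym (ℕₚ.+-suc m _)) eq)
... | refl = us , refl , x , here , refl
ungraft x m (node _ (u ∷ us′)) us eq
  with ungraft (+ (m + vertices us)) (suc (m + vertices us)) u us′ (trans (number-shift m _ _) eq)
... | vs , eq′ , p , s , num≡ =
  node tt vs ∷ us , trans (sym (number-shift m (vertices us) (vertices vs))) eq′ , p , down s ,
  cong (λ t → node x (t ∷ _)) num≡

engraft : ∀ x m vs {p c} → m + vertices vs ≡ c → (s : Spine p (node x (numberAll m vs))) →
          ∃[ us ] m + vertices us ≡ suc c × node x (numberAll m us) ≡ graft (+ c) s
engraft x m [] refl here         = node tt [] ∷ [] , ℕₚ.+-suc m 0 , refl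
engraft x m us@(_ ∷ _) refl here = node tt [] ∷ us , ℕₚ.+-suc m _ , refl
engraft x m (node _ vs ∷ us) eq (down s)
  with engraft _ _ vs (trans (number-shift m (vertices us) (vertices vs)) eq) s
... | ws , eq′ , num≡ =
  node tt ws ∷ us , trans (sym (number-shift m (vertices us) (vertices ws))) eq′ ,
  cong (λ t → node x (t ∷ _)) num≡

ungraftForest : ∀ (f : Vec PlanarTree j) {n} → forestEdges f ≡ suc n →
                ∃[ g ] forestEdges g ≡ n ×
                ∃[ p ] Σ[ s ∈ ForestSpine p (canonical g) ] canonical f ≡ graftForest (+ suc n) s
ungraftForest (node _ [] ∷ f) eq with ungraftForest f eq
... | g , eq′ , p , s , f≡ = node tt [] ∷ g , eq′ , p , next s , cong (_ ∷_) f≡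
ungraftForest (node _ (u ∷ us) ∷ f) eq
  -- The leftmost tree is numbered last, starting just above the edge count of the trees to its
  -- right, whereas `forestEdges` counts it first.
  with ungraft _ _ u us (cong suc (trans (ℕₚ.+-comm (forestEdges f) (vertices (u ∷ us))) eq))
... | vs , eq′ , p , s , t≡ =
  node tt vs ∷ f , trans (ℕₚ.+-comm (vertices vs) (forestEdges f)) (ℕₚ.suc-injective eq′) ,
  p , stay s , cong (_∷ _) t≡

engraftForest : ∀ (g : Vec PlanarTree j) {n} → forestEdges g ≡ n → (s : ForestSpine p (canonical g)) →
                ∃[ f ] forestEdges f ≡ suc n × canonical f ≡ graftForest (+ suc n) s
engraftForest {j = suc j} (node _ [] ∷ g) refl (stay here) =
  node tt (node tt [] ∷ []) ∷ g , refl ,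
  cong (λ n → node (- (+ j)) (node (+ n) [] ∷ []) ∷ canonical g) (ℕₚ.+-identityʳ (suc (forestEdges g)))
engraftForest (node _ [] ∷ g) eq (next s) with engraftForest g eq s
... | f , eq′ , f≡ = node tt [] ∷ f , eq′ , cong (_ ∷_) f≡
engraftForest (node _ (v ∷ vs) ∷ g) eq (stay s)
  with engraft _ _ (v ∷ vs) (cong suc (trans (ℕₚ.+-comm (forestEdges g) (vertices (v ∷ vs))) eq)) s
... | us , eq′ , t≡ =
  node tt us ∷ g , trans (ℕₚ.+-comm (vertices us) (forestEdges g)) (ℕₚ.suc-injective eq′) , cong (_∷ _) t≡

-- Forests without edges

bare : ∀ j → Vec PlanarTree j
bare zero    = []
bare (suc j) = node tt [] ∷ bare j

edgeless⇒bare : ∀ (f : Vec PlanarTree j) → forestEdges f ≡ 0 → f ≡ bare j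
edgeless⇒bare []              eq = refl
edgeless⇒bare (node _ [] ∷ f) eq = cong (_ ∷_) (edgeless⇒bare f eq)

-- Without edges nothing stops `next`, so the spine consists of all the roots.
bare-spine⁻ : ∀ j → ForestSpine q (canonical (bare j)) → ∃[ i ] i < j × q ≡ - (+ i)
bare-spine⁻ (suc j) (stay here) = j , ℕₚ.n<1+n j , refl
bare-spine⁻ (suc j) (next s) with bare-spine⁻ j s
... | i , i<j , eq = i , ℕₚ.m<n⇒m<1+n i<j , eq

bare-spine⁺ : ∀ {i} j → i < j → ForestSpine (- (+ i)) (canonical (bare j))
bare-spine⁺ (suc j) (s≤s i≤j) with ℕₚ.m≤n⇒m<n∨m≡n i≤j
... | inj₁ i<j  = next (bare-spine⁺ j i<j)
... | inj₂ refl = stay here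

bare-edges : ∀ j → forestEdges (bare j) ≡ 0
bare-edges zero    = refl
bare-edges (suc j) = bare-edges j

-- The assembly procedure

canonicalSpine : ∀ {k n} → Forest k n → ℤ → Set
canonicalSpine (f , _) q = ForestSpine q (canonical f)

-- Ancestors are recorded by label, for comparison with spines; the trivial path makes `v` its own
-- ancestor.
Ancestor : ∀ k n → A.Vertex k n → ℤ → Set
Ancestor k n v q = ∃[ u ] A.Path k n u v × value (A.label k n u) ≡ q

forest-≡ : ∀ {k n} {F G : Forest k n} → proj₁ F ≡ proj₁ G → F ≡ G
forest-≡ {F = f , a} {.f , b} refl = cong (f ,_) (uip a b)

edgeless-unique : ∀ {k} (F G : Forest k 0) → F ≡ G
edgeless-unique (f , f≡0) (g , g≡0) =
  forest-≡ (trans (edgeless⇒bare f f≡0) (sym (edgeless⇒bare g g≡0)))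

-- This replaces the first two premises of `step`. The equation between canonical labelings fixes
-- both the shape of `F` and the label of the new vertex.
record LastVertex {k n} (F : Forest k (suc n)) (F′ : Forest k n) (p : ℤ) : Set where
  constructor lastVertex
  field
    spine : canonicalSpine F′ p
    graft≡ : canonical (proj₁ F) ≡ graftForest (+ suc n) spine

open LastVertex

remove : ∀ {k n} (F : Forest k (suc n)) → ∃[ F′ ] ∃[ p ] LastVertex F F′ p
remove (f , eq) with ungraftForest f eq
... | g , eq′ , p , s , f≡ = (g , eq′) , p , lastVertex s f≡

extend : ∀ {k n p} (F′ : Forest k n) → canonicalSpine F′ p → ∃[ F ] LastVertex F F′ p
extend (g , eq) s with engraftForest g eq s
... | f , eq′ , f≡ = (f , eq′) , lastVertex s f≡

module _ {k n p} {F : Forest k (suc n)} {F′ : Forest k n} (L : LastVertex F F′ p) where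

  private
    absent : VecAll.All (Absent (+ suc n)) (canonical (proj₁ F′))
    absent = canonical-absent (proj₁ F′) (ℕₚ.≤-reflexive (proj₂ F′))

  lastVertex-parent : ParentLabel F (+ suc n) p
  lastVertex-parent = subst (VecAny.Any (ParentIn p (+ suc n))) (sym (graft≡ L)) (parent-graftForest (spine L))

  lastVertex-parent-unique : ParentLabel F (+ suc n) q → q ≡ p
  lastVertex-parent-unique i = parent-graftForest-unique absent (spine L)
    (subst (VecAny.Any (ParentIn _ (+ suc n))) (graft≡ L) i)

  lastVertex-delete : proj₁ F′ ≡ deleteVertex (+ suc n) F
  lastVertex-delete = sym (begin
    Vec.map (erase ∘ delete (+ suc n)) (canonical (proj₁ F))
      ≡⟨ Vecₚ.map-∘ erase (delete (+ suc n)) (canonical (proj₁ F)) ⟩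
    Vec.map erase (Vec.map (delete (+ suc n)) (canonical (proj₁ F)))
      ≡⟨ cong (Vec.map erase ∘ Vec.map (delete (+ suc n))) (graft≡ L) ⟩
    Vec.map erase (Vec.map (delete (+ suc n)) (graftForest (+ suc n) (spine L)))
      ≡⟨ cong (Vec.map erase) (delete-graftForest absent (spine L)) ⟩
    Vec.map erase (canonical (proj₁ F′))
      ≡⟨ erase-canonical (proj₁ F′) ⟩
    proj₁ F′ ∎)
    where open ≡-Reasoning

-- The premises determine `p` and `F′` from `F`, so these are the ones that `remove` produces.
parent-delete⇒lastVertex : ∀ {k n p} {F : Forest k (suc n)} {F′ : Forest k n} →
                           ParentLabel F (+ suc n) p → proj₁ F′ ≡ deleteVertex (+ suc n) F →
                           LastVertex F F′ p
parent-delete⇒lastVertex {F = F} {F′} i d with remove F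
... | G , q , L with lastVertex-parent-unique L i
                   | forest-≡ {F = F′} {G} (trans d (sym (lastVertex-delete L)))
...   | refl | refl = L

lastVertex-injective : ∀ {k n p} {F₁ F₂ : Forest k (suc n)} {F′ : Forest k n} →
                       LastVertex F₁ F′ p → LastVertex F₂ F′ p → F₁ ≡ F₂
lastVertex-injective {F′ = F′} (lastVertex s₁ eq₁) (lastVertex s₂ eq₂)
  with forestSpine-unique (canonical-increasing (proj₁ F′)) s₁ s₂
... | refl = forest-≡ (canonical-injective (trans eq₁ (sym eq₂)))

-- Ancestors of a new vertex

path-from-new : ∀ {k n} {u v : A.Vertex k n} {ℓ : value (A.label k n v) ≡ + n} {π : A.Path k n u v} {w} →
                A.Path k (suc n) (new ℓ π) w → w ≡ new ℓ π
path-from-new ε        = refl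
path-from-new (() ◅ _)

path-to-new : ∀ {k n} {u v : A.Vertex k n} {ℓ : value (A.label k n v) ≡ + n} {π : A.Path k n u v} {w} →
              A.Path k (suc n) (old w) (new ℓ π) → A.Path k n w u
path-to-new (old e ◅ ρ)   = e ◅ path-to-new ρ
path-to-new {n = n} (new _ _ ◅ ρ) with path-from-new {n = n} ρ
... | refl = ε

module _ {k n} {u v : A.Vertex k n} {ℓ : value (A.label k n v) ≡ + n} {π : A.Path k n u v} where

  -- The proper ancestors of the new vertex are those of `u`, with `u` included. They are expressed
  -- as ancestors of `v` with bounded label, to parallel `forestSpine-graft⁻`.
  ancestor-new⁻ : Ancestor k (suc n) (new ℓ π) q →
                  q ≡ + suc n ⊎ Ancestor k n v q × q ℤ.≤ value (A.label k n u)
  ancestor-new⁻ (new _ _ , ρ , refl) = inj₁ refl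
  ancestor-new⁻ (old w , ρ , refl)   =
    inj₂ ((w , σ ◅◅ π , refl) , ActionGraph.path-≤ k n σ)
    where
    σ = path-to-new ρ

  ancestor-new-old : Ancestor k n v q → q ℤ.≤ value (A.label k n u) →
                     Ancestor k (suc n) (new ℓ π) q
  ancestor-new-old (w , ρ , refl) q≤ =
    old w , gmap old old (ActionGraph.path-back k n ρ π q≤) ◅◅ (new ℓ π ◅ ε) , refl

-- The invariant of the recursion: the parents available for the next vertex of the forest
-- correspond to the sources of paths into `v`.
Matches : ∀ {k n} → Forest k n → A.Vertex k n → Set
Matches {k} {n} F v = ∀ {q} → canonicalSpine F q ⇔ Ancestor k n v q

matches-base : ∀ {k} {F : Forest k 0} {v : A.Vertex k 0} → value (A.label k 0 v) ≡ + 0 → Matches F v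
matches-base {k} {f , f≡0} {v} ℓ with linear-label-0 {k} {v} ℓ | edgeless⇒bare f f≡0
... | refl | refl = mk⇔ to from
  where
  to : ForestSpine q (canonical (bare (suc k))) → Ancestor k 0 (fromℕ k) q
  to s with bare-spine⁻ (suc k) s
  ... | i , s≤s i≤k , refl = w , linear-path i i+w≡k , label≡
    where
    k∸i≤k = ℕₚ.m∸n≤m k i
    -- Labels of the linear graph start at `- k`, so the label `- i` sits at position `k ∸ i`.
    w = fromℕ< (s≤s k∸i≤k)
    toℕ-w : toℕ w ≡ k ∸ i
    toℕ-w = Finₚ.toℕ-fromℕ< (s≤s k∸i≤k)
    i+w≡k : i + toℕ w ≡ toℕ (fromℕ k)
    i+w≡k = trans (cong (_+_ i) toℕ-w) (trans (ℕₚ.m+[n∸m]≡n i≤k) (sym (Finₚ.toℕ-fromℕ k)))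
    label≡ : toℕ w ⊖ k ≡ - (+ i)
    label≡ = trans (cong (_⊖ k) toℕ-w)
                   (trans (ℤₚ.⊖-≤ k∸i≤k) (cong (λ m → - (+ m)) (ℕₚ.m∸[m∸n]≡n i≤k)))

  from : Ancestor k 0 (fromℕ k) q → ForestSpine q (canonical (bare (suc k)))
  from (w , _ , refl) =
    subst (λ p → ForestSpine p (canonical (bare (suc k)))) (sym (ℤₚ.⊖-≤ (Finₚ.toℕ≤pred[n] w)))
          (bare-spine⁺ (suc k) (s≤s (ℕₚ.m∸n≤m k (toℕ w))))

matches-step : ∀ {k n} {F : Forest k (suc n)} {F′ : Forest k n} {u v : A.Vertex k n}
               {ℓ : value (A.label k n v) ≡ + n} {π : A.Path k n u v} →
               LastVertex F F′ (value (A.label k n u)) → Matches F′ v → Matches F (new ℓ π)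
matches-step {k} {n} {F} {F′} {u} {v} {ℓ} {π} (lastVertex s F≡) match = mk⇔ to from
  where
  increasing = canonical-increasing (proj₁ F′)
  to : canonicalSpine F q → Ancestor k (suc n) (new ℓ π) q
  to r with forestSpine-graft⁻ increasing s (subst (ForestSpine _) F≡ r)
  ... | inj₁ refl      = new ℓ π , ε , refl
  ... | inj₂ (r′ , q≤) = ancestor-new-old (Equivalence.to match r′) q≤
  from : Ancestor k (suc n) (new ℓ π) q → canonicalSpine F q
  from a = subst (ForestSpine _) (sym F≡) (onGraft (ancestor-new⁻ a))
    where
    onGraft : q ≡ + suc n ⊎ Ancestor k n v q × q ℤ.≤ value (A.label k n u) →
              ForestSpine q (graftForest (+ suc n) s)
    onGraft (inj₁ refl)     = forestSpine-graft-new s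
    onGraft (inj₂ (b , q≤)) = forestSpine-graft-old increasing s (Equivalence.from match b) q≤

-- The procedure is well defined and bijective

⇝-matches : ∀ {k n} {F : Forest k n} {v : A.Vertex k n} → F ⇝ v → Matches F v
⇝-matches {F = F} {v} (base ℓ) = matches-base {F = F} {v} ℓ
⇝-matches {F = F} (step {F′ = F′} i d F′⇝v′ ℓ σ refl π) =
  matches-step {ℓ = ℓ} {π} (parent-delete⇒lastVertex {F = F} {F′} i d) (⇝-matches F′⇝v′)

⇝-label : ∀ {k n} {F : Forest k n} {v : A.Vertex k n} → F ⇝ v → value (A.label k n v) ≡ + n
⇝-label (base ℓ)               = ℓ
⇝-label (step _ _ _ _ _ _ _)   = refl

⇝-step : ∀ {k n} {F : Forest k (suc n)} {F′ : Forest k n} {u v : A.Vertex k n} →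
         LastVertex F F′ (value (A.label k n u)) → F′ ⇝ v → (ℓ : value (A.label k n v) ≡ + n) →
         (π : A.Path k n u v) → F ⇝ new ℓ π
⇝-step {k} {n} {u = u} L F′⇝v ℓ π =
  step (lastVertex-parent L) (lastVertex-delete L) F′⇝v ℓ (ActionGraph.reachable k n u) refl π

⇝-total : ∀ {k} n (F : Forest k n) → Σ[ v ∈ A.Vertex k n ] F ⇝ v
⇝-total {k} zero F = fromℕ k , base (trans (cong (_⊖ k) (Finₚ.toℕ-fromℕ k)) (ℤₚ.n⊖n≡0 k))
⇝-total (suc n) F with remove F
... | F′ , p , L with ⇝-total n F′
-- The invariant supplies the vertex labeled `p` on the way to `v`, which is the existence claim in
-- the procedure.
...   | v , F′⇝v with Equivalence.to (⇝-matches F′⇝v) (spine L)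
...     | u , π , refl = _ , ⇝-step L F′⇝v (⇝-label F′⇝v) π

⇝-functional : ∀ {k n} {F : Forest k n} {v w : A.Vertex k n} → F ⇝ v → F ⇝ w → v ≡ w
⇝-functional (base ℓ) (base ℓ′) = trans (linear-label-0 ℓ) (sym (linear-label-0 ℓ′))
⇝-functional {k} {suc n} {F} (step {F′ = F₁} i₁ d₁ F₁⇝v₁ ℓ₁ _ u₁≡p π₁)
                             (step {F′ = F₂} i₂ d₂ F₂⇝v₂ ℓ₂ _ u₂≡p π₂)
  with forest-≡ {F = F₁} {F₂} (trans d₁ (sym d₂))
... | refl with ⇝-functional F₁⇝v₁ F₂⇝v₂
-- Both starting vertices are ancestors of the same vertex, and both carry the unique parent label
-- in `F`.
...   | refl with ActionGraph.label-injective k n π₁ π₂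
                    (trans u₁≡p (trans (lastVertex-parent-unique (parent-delete⇒lastVertex {F = F} {F₂} i₂ d₂) i₁)
                                       (sym u₂≡p)))
...     | refl = cong₂ new (uip ℓ₁ ℓ₂) (ActionGraph.path-irrelevant k n π₁ π₂)

-- A new vertex determines `v′` and `u`, hence by induction the smaller forest, and the label below
-- which the last vertex is grafted.
⇝-injective : ∀ {k n} {F G : Forest k n} {v : A.Vertex k n} → F ⇝ v → G ⇝ v → F ≡ G
⇝-injective (base _) (base _) = edgeless-unique _ _
⇝-injective {F = F} {G} (step {F′ = F′} i₁ d₁ F′⇝v _ _ refl _) (step {F′ = G′} i₂ d₂ G′⇝v _ _ refl _)
  with ⇝-injective F′⇝v G′⇝v
... | refl = lastVertex-injective (parent-delete⇒lastVertex {F = F} {F′} i₁ d₁)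
                                  (parent-delete⇒lastVertex {F = G} {G′} i₂ d₂)

⇝-surjective : ∀ {k} n {v : A.Vertex k n} → value (A.label k n v) ≡ + n → Σ[ F ∈ Forest k n ] F ⇝ v
⇝-surjective {k} zero ℓ = (bare (suc k) , bare-edges (suc k)) , base ℓ
⇝-surjective {k} (suc n) {old v} ℓ =
  contradiction (A-label≤ k n v) (ℤₚ.<⇒≱ (subst (+ n ℤ.<_) (sym ℓ) (ℤ.+<+ (ℕₚ.n<1+n n))))
⇝-surjective (suc n) {new {u} ℓ π} _ with ⇝-surjective n ℓ
-- As the source of `π`, `u` is an ancestor of the end of `π`, so the invariant puts its label on
-- the spine of `F′`.
... | F′ , F′⇝v with extend F′ (Equivalence.from (⇝-matches F′⇝v) (u , π , refl))
...   | F , L = F , ⇝-step L F′⇝v ℓ π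

theorem5p3 : (k n : ℕ) →
    Σ[ Φ ∈ (Forest k n → Leaf k n) ]
    ((∀ F v → (F ⇝ v) ⇔ (v ≡ proj₁ (Φ F)))
    × Bijective _≡_ (_≡_ on proj₁) Φ)
theorem5p3 k n = Φ , graph , injective , surjective
  where
  Φ : Forest k n → Leaf k n
  Φ F = let v , F⇝v = ⇝-total n F in v , label-leaf k n (⇝-label F⇝v)

  F⇝Φ : ∀ F → F ⇝ proj₁ (Φ F)
  F⇝Φ F = proj₂ (⇝-total n F)

  graph : ∀ F v → (F ⇝ v) ⇔ (v ≡ proj₁ (Φ F))
  graph F v = mk⇔ (λ F⇝v → ⇝-functional F⇝v (F⇝Φ F)) (λ { refl → F⇝Φ F })

  injective : ∀ {F G} → proj₁ (Φ F) ≡ proj₁ (Φ G) → F ≡ G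
  injective {F} {G} eq = ⇝-injective (F⇝Φ F) (subst (G ⇝_) (sym eq) (F⇝Φ G))

  surjective : ∀ (l : Leaf k n) → ∃[ F ] (∀ {G} → G ≡ F → proj₁ (Φ G) ≡ proj₁ l)
  surjective (v , v-leaf) with ⇝-surjective n (leaf-label k n v-leaf)
  ... | F , F⇝v = F , λ { refl → ⇝-functional (F⇝Φ F) F⇝v }
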